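{- For every positive integer $n$: (1) every graph $H$ with no isolated edge satisfies $\mathrm{sat}^*(n,H) \ge \mathrm{ssat}(n,H) \ge \left\lfloor \frac{n}{2} \right\rfloor$; (2) if $H$ is a connected graph containing a cycle, then $\mathrm{sat}^*(n,H) \ge \mathrm{ssat}(n,H)\ge n-1$.
   Context: All graphs are finite and simple. An isolated edge of a graph is a connected component isomorphic to $K_2$. An edge-colouring of a graph is proper if incident edges receive different colours, and a subgraph is rainbow if all of its edges receive pairwise distinct colours. A graph $G$ is properly rainbow $H$-saturated if (1) there is a proper edge-colouring of $G$ (with any set of colours) containing no rainbow copy of $H$, and (2) for every edge $e$ of the complement $\overline{G}$, every proper edge-colouring of $G+e$ contains a rainbow copy of $H$. The proper rainbow saturation number $\mathrm{sat}^*(n,H)$ is the minimum number of edges in an $n$-vertex properly rainbow $H$-saturated graph. A graph $G$ is $H$-semi-saturated if for every $e \in E(\overline{G})$, the graph $G+e$ contains a copy $H'$ of $H$ with $e \in E(H')$ ($G$ itself need not be $H$-free). $\mathrm{ssat}(n,H)$ is the minimum number of edges in an $H$-semi-saturated graph on $n$ vertices. -}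

module Defs where

open import Data.Fin.Base using (Fin; zero; suc; fromℕ; inject₁)
open import Data.Fin.Properties using (_≟_; _<?_)
open import Data.List.Base using (List; length; filter; cartesianProduct; allFin)
open import Data.Nat.Base using (ℕ; _+_; _≤_)
open import Data.Product using (Σ; ∃; ∃-syntax; _×_; _,_; proj₁)
open import Data.Sum.Base using (_⊎_; inj₁; inj₂; [_,_]; map; swap)
open import Function.Base using (_∘_)
open import Function.Bundles using (_⇔_)
open import Function.Definitions using (Injective)
open import Level using (Level; 0ℓ; _⊔_) renaming (suc to lsuc)
open import Relation.Binary.Construct.Closure.ReflexiveTransitive using (Star)
open import Relation.Binary.Core using (Rel)
open import Relation.Binary.Definitions using (Decidable; DecidableEquality; Symmetric)
open import Relation.Binary.PropositionalEquality using (_≡_; _≢_; refl; sym; trans)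
open import Relation.Nullary using (¬_)
open import Relation.Nullary.Decidable using (_×-dec_; _⊎-dec_; ¬?)

private
  variable
    k n : ℕ

record Graph (n : ℕ) : Set₁ where
  field
    Adj    : Rel (Fin n) 0ℓ
    adj?   : Decidable Adj
    adjSym : Symmetric Adj
    noLoop : ∀ {u} → ¬ Adj u u

open Graph public

-- Each edge is listed once, with its smaller endpoint first.
edges : Graph n → List (Fin n × Fin n)
edges {n} G =
  filter (λ (u , v) → (u <? v) ×-dec adj? G u v) (cartesianProduct (allFin n) (allFin n))

edgeCount : Graph n → ℕ
edgeCount G = length (edges G)

complement : Graph n → Graph n
complement G = record
  { Adj    = λ u v → u ≢ v × ¬ Adj G u v
  ; adj?   = λ u v → ¬? (u ≟ v) ×-dec ¬? (adj? G u v)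
  ; adjSym = λ (u≢v , ¬uv) → (u≢v ∘ sym) , (¬uv ∘ adjSym G)
  ; noLoop = λ (u≢u , _) → u≢u refl
  }

-- Equality of the unordered pairs {u , v} and {x , y}.
SamePair : (u v x y : Fin n) → Set
SamePair u v x y = (x ≡ u × y ≡ v) ⊎ (x ≡ v × y ≡ u)

addEdge : (G : Graph n) (u v : Fin n) → u ≢ v → Graph n
addEdge G u v u≢v = record
  { Adj    = λ x y → Adj G x y ⊎ SamePair u v x y
  ; adj?   = λ x y → adj? G x y ⊎-dec
               (((x ≟ u) ×-dec (y ≟ v)) ⊎-dec ((x ≟ v) ×-dec (y ≟ u)))
  ; adjSym = map (adjSym G) (swap ∘ map (λ (p , q) → q , p) (λ (p , q) → q , p))
  ; noLoop = [ noLoop G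
             , [ (λ (p , q) → u≢v (trans (sym p) q))
               , (λ (p , q) → u≢v (trans (sym q) p)) ] ]
  }

Reachable : (G : Graph n) → Rel (Fin n) 0ℓ
Reachable G = Star (Adj G)

Connected : Graph n → Set
Connected G = ∀ u v → Reachable G u v

ContainsCycle : Graph n → Set
ContainsCycle {n} G = ∃[ l ] Σ (Fin (3 + l) → Fin n) λ c →
    Injective _≡_ _≡_ c
  × (∀ i → Adj G (c (inject₁ i)) (c (suc i)))
  × Adj G (c (fromℕ (2 + l))) (c zero)

-- The component of u has vertex set {u , v} and u v is an edge of it,
-- that is, this component is a K₂.
IsolatedEdge : (G : Graph n) (u v : Fin n) → Set
IsolatedEdge G u v = Adj G u v × (∀ w → Reachable G u w ⇔ (w ≡ u ⊎ w ≡ v))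

NoIsolatedEdge : Graph n → Set
NoIsolatedEdge G = ∀ u v → ¬ IsolatedEdge G u v

-- A copy of H in G is a subgraph of G, not necessarily induced.
record Copy (H : Graph k) (G : Graph n) : Set where
  field
    embed     : Fin k → Fin n
    injective : Injective _≡_ _≡_ embed
    preserves : ∀ {x y} → Adj H x y → Adj G (embed x) (embed y)

open Copy public

CopyUses : {H : Graph k} {G : Graph n} → Copy H G → (u v : Fin n) → Set
CopyUses {H = H} f u v = ∃[ x ] ∃[ y ] Adj H x y × SamePair u v (embed f x) (embed f y)

-- The palette is arbitrary.  Only the values of colour on edges are ever used.
record ProperColouring (G : Graph n) : Set₁ where
  field
    Colour    : Set
    _≟ᶜ_      : DecidableEquality Colour
    colour    : Fin n → Fin n → Colour
    colourSym : ∀ u v → colour u v ≡ colour v u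
    proper    : ∀ {u v w} → Adj G u v → Adj G u w → v ≢ w → colour u v ≢ colour u w

open ProperColouring public using (Colour; colour; colourSym; proper)

Rainbow : {H : Graph k} {G : Graph n} → ProperColouring G → Copy H G → Set
Rainbow {H = H} c f = ∀ {x y x′ y′} → Adj H x y → Adj H x′ y′ → ¬ SamePair x y x′ y′ →
  colour c (embed f x) (embed f y) ≢ colour c (embed f x′) (embed f y′)

HasRainbowCopy : (H : Graph k) {G : Graph n} → ProperColouring G → Set
HasRainbowCopy H {G} c = Σ (Copy H G) (Rainbow c)

ProperlyRainbowSaturated : (H : Graph k) → Graph n → Set₁
ProperlyRainbowSaturated H G =
    (Σ (ProperColouring G) λ c → ¬ HasRainbowCopy H c)
  × (∀ u v (e : Adj (complement G) u v) (c : ProperColouring (addEdge G u v (proj₁ e))) →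
       HasRainbowCopy H c)

SemiSaturated : (H : Graph k) → Graph n → Set
SemiSaturated H G = ∀ u v (e : Adj (complement G) u v) →
  Σ (Copy H (addEdge G u v (proj₁ e))) λ f → CopyUses f u v

IsMinEdgeCount : ∀ {ℓ} → (Graph n → Set ℓ) → ℕ → Set (lsuc 0ℓ ⊔ ℓ)
IsMinEdgeCount P m = (∃[ G ] P G × edgeCount G ≡ m) × (∀ G → P G → m ≤ edgeCount G)

-- The invariants are stated as "the value is m".  sat*(n,H) has no value when no
-- n-vertex graph is properly rainbow H-saturated (H edgeless with at most n
-- vertices); any lower bound on sat*(n,H) then holds, as with min ∅ = ∞.
sat*[_,_]≡_ : (n : ℕ) → Graph k → ℕ → Set₁
sat*[ n , H ]≡ m = IsMinEdgeCount {n} (ProperlyRainbowSaturated H) m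

ssat[_,_]≡_ : (n : ℕ) → Graph k → ℕ → Set₁
ssat[ n , H ]≡ m = IsMinEdgeCount {n} (SemiSaturated H) m

{-# OPTIONS --safe #-}

-- Giving a fresh colour to the added edge e shows that the rainbow copy of H in G + e
-- must use e, so properly rainbow saturated graphs are semi-saturated.
--
-- Let G be H-semi-saturated.  If u and v are isolated in G, then uv is an isolated edge
-- of G + uv, and the copy of H through uv gives an isolated edge of H.  So if H has none,
-- at most one vertex of G is isolated.  If u and v lie in distinct tree components of G,
-- then the component of uv in G + uv is a tree, which contains no copy of a connected
-- graph with a cycle.  So for such H at most one component of G is a tree; adding the
-- edges of G one at a time destroys at most one tree component each, and there are n
-- of them at the start, so G has at least n - 1 edges.
module Submission where

open import Defs
open import Data.Nat.Base using (ℕ; NonZero; _≤_; _≥_; _∸_; ⌊_/2⌋)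
open import Data.Product using (∃-syntax; _×_)

open import Data.Empty using (⊥)
open import Data.Fin.Base using (Fin; zero; suc; fromℕ; inject₁; finToFun; funToFin)
open import Data.Fin.Induction using (<-weakInduction)
import Data.Fin.Properties as Fin
open import Data.Fin.Properties using (_≟_; fromℕ≢inject₁)
open import Data.List.Base
  using (List; []; _∷_; _++_; length; map; filter; cartesianProduct; allFin)
open import Data.List.Extrema.Nat using (argmin; argmin-all; f[argmin]≤f[xs])
open import Data.List.Membership.DecPropositional using (_∈?_)
open import Data.List.Membership.Propositional using (_∈_; _∉_)
open import Data.List.Membership.Propositional.Properties
  using (∈-filter⁺; ∈-cartesianProduct⁺; ∈-allFin; ∈-map⁺; ∈-++⁺ˡ; ∈-++⁺ʳ)
open import Data.List.Membership.Setoid.Properties using (index-injective)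
open import Data.List.Properties using (filter-≐; length-++; length-map)
import Data.List.Relation.Unary.All as All
open import Data.List.Relation.Unary.All.Properties using (all-filter)
open import Data.List.Relation.Unary.Any as Any using (here; there)
open import Data.Maybe.Base using (Maybe; just; nothing)
open import Data.Maybe.Properties using (just-injective) renaming (≡-dec to ≡-decᴹ)
open import Data.Nat.Base using (suc; _+_; _^_; _<_)
import Data.Nat.Properties as ℕ
open import Data.Product as Product using (Σ; ∃; _,_; proj₁; proj₂)
open import Data.Sum.Base as Sum using (_⊎_; inj₁; inj₂; [_,_]′)
open import Function.Base using (_∘_; id)
open import Function.Bundles using (mk⇔)
open import Function.Definitions using (Injective)
open import Relation.Binary.Construct.Closure.ReflexiveTransitive using (ε; _◅_)
open import Relation.Binary.Definitions using (tri<; tri≈; tri>)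
open import Relation.Binary.PropositionalEquality
  using (_≡_; _≢_; _≗_; refl; sym; trans; cong; cong₂; subst; subst₂; setoid)
open import Relation.Nullary using (¬_; Dec; yes; no; contradiction)
open import Relation.Nullary.Decidable using (map′; decidable-stable; ¬?; _×-dec_; _⊎-dec_; _→-dec_)
open import Relation.Unary using (Pred; Decidable)

private
  variable
    k n : ℕ

-- Vertices missing from a list, and search over finite function spaces.

-- If every vertex occurred in `xs`, its position would inject `Fin n` into `Fin (length xs)`.
∃-missing : (xs : List (Fin n)) → length xs < n → ∃[ v ] v ∉ xs
∃-missing {n} xs len<n with Fin.any? (λ v → ¬? (_∈?_ _≟_ v xs))
... | yes missing = missing
... | no  none    = contradiction len<n (ℕ.≤⇒≯ (Fin.injective⇒≤ position-injective))
  where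
  ∈xs : ∀ v → v ∈ xs
  ∈xs v = decidable-stable (_∈?_ _≟_ v xs) (λ v∉xs → none (v , v∉xs))

  position-injective : Injective _≡_ _≡_ (λ v → Any.index (∈xs v))
  position-injective {u} {v} = index-injective (setoid (Fin n)) (∈xs u) (∈xs v)

-- Both lower bounds come from this count: `xs` will be the list of endpoints of edges, and later
-- the list of spoiled labels.
missing-unique⇒≤ : (xs : List (Fin n)) →
  (∀ {u v} → u ≢ v → u ∉ xs → v ∉ xs → ⊥) → n ≤ suc (length xs)
missing-unique⇒≤ xs unique = ℕ.≮⇒≥ λ 1+len<n →
  let u , u∉xs   = ∃-missing xs (ℕ.<-trans (ℕ.n<1+n _) 1+len<n)
      v , v∉u∷xs = ∃-missing (u ∷ xs) 1+len<n
  in unique (λ u≡v → v∉u∷xs (here (sym u≡v))) u∉xs (v∉u∷xs ∘ there)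

-- Functions are searched through their finitely many codes. Decoding returns a function only up to
-- pointwise equality, hence the hypothesis that `P` respects it.
any-function? : ∀ {p} {P : Pred (Fin k → Fin n) p} →
  (∀ {f g} → f ≗ g → P f → P g) → Decidable P → Dec (∃ P)
any-function? resp P? = map′
  (λ (i , Pi) → finToFun i , Pi)
  (λ (f , Pf) → funToFin f , resp (sym ∘ Fin.finToFun-funToFin f) Pf)
  (Fin.any? (P? ∘ finToFun))

samePair? : (u v x y : Fin n) → Dec (SamePair u v x y)
samePair? u v x y = ((x ≟ u) ×-dec (y ≟ v)) ⊎-dec ((x ≟ v) ×-dec (y ≟ u))

samePair-sym : {u v x y : Fin n} → SamePair u v x y → SamePair u v y x
samePair-sym = Sum.swap ∘ Sum.map Product.swap Product.swap

samePair-functional : {u v x y z : Fin n} → u ≢ v → SamePair u v x y → SamePair u v x z → y ≡ z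
samePair-functional u≢v (inj₁ (refl , refl)) (inj₁ (_    , refl)) = refl
samePair-functional u≢v (inj₁ (refl , _))    (inj₂ (u≡v  , _))    = contradiction u≡v u≢v
samePair-functional u≢v (inj₂ (refl , _))    (inj₁ (v≡u  , _))    = contradiction (sym v≡u) u≢v
samePair-functional u≢v (inj₂ (refl , refl)) (inj₂ (_    , refl)) = refl

-- Edge lists, copies, and deciding semi-saturation.

infix 4 _⊆_

_⊆_ : Graph n → Graph n → Set
G ⊆ G′ = ∀ {u v} → Adj G u v → Adj G′ u v

Joined : List (Fin n × Fin n) → Fin n → Fin n → Set
Joined es u v = (u , v) ∈ es ⊎ (v , u) ∈ es

Adj⇒Joined : (G : Graph n) → ∀ {u v} → Adj G u v → Joined (edges G) u v
Adj⇒Joined {n} G {u} {v} uv with Fin.<-cmp u v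
... | tri< u<v _ _ = inj₁ (∈-filter⁺ _ (∈-cartesianProduct⁺ (∈-allFin u) (∈-allFin v)) (u<v , uv))
... | tri≈ _ refl _ = contradiction uv (noLoop G)
... | tri> _ _ v<u =
  inj₂ (∈-filter⁺ _ (∈-cartesianProduct⁺ (∈-allFin v) (∈-allFin u)) (v<u , adjSym G uv))

edgeCount-cong : (G G′ : Graph n) → G ⊆ G′ → G′ ⊆ G → edgeCount G ≡ edgeCount G′
edgeCount-cong {n} G G′ G⊆G′ G′⊆G = cong length (filter-≐
  (λ (u , v) → (u Fin.<? v) ×-dec adj? G u v)
  (λ (u , v) → (u Fin.<? v) ×-dec adj? G′ u v)
  ((λ (u<v , uv) → u<v , G⊆G′ uv) , (λ (u<v , uv) → u<v , G′⊆G uv))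
  (cartesianProduct (allFin n) (allFin n)))

mapCopy : {H : Graph k} {G G′ : Graph n} → G ⊆ G′ → Copy H G → Copy H G′
mapCopy G⊆G′ f = record
  { embed = embed f ; injective = injective f ; preserves = G⊆G′ ∘ preserves f }

copyUses? : {H : Graph k} {G : Graph n} (f : Copy H G) (u v : Fin n) → Dec (CopyUses f u v)
copyUses? {H = H} f u v = Fin.any? λ x → Fin.any? λ y →
  adj? H x y ×-dec samePair? u v (embed f x) (embed f y)

copyUsing? : (H : Graph k) (G : Graph n) (u v : Fin n) →
  Dec (Σ (Copy H G) λ f → CopyUses f u v)
copyUsing? {k} {n} H G u v = map′ to from (any-function? resp dec)
  where
  IsCopyUsing : (Fin k → Fin n) → Set
  IsCopyUsing f =
      (∀ x y → f x ≡ f y → x ≡ y)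
    × (∀ x y → Adj H x y → Adj G (f x) (f y))
    × ∃[ x ] ∃[ y ] Adj H x y × SamePair u v (f x) (f y)

  resp : ∀ {f g} → f ≗ g → IsCopyUsing f → IsCopyUsing g
  resp f≗g (inj , pres , x , y , xy , same) =
      (λ x y gx≡gy → inj x y (trans (f≗g x) (trans gx≡gy (sym (f≗g y)))))
    , (λ x y xy → subst₂ (Adj G) (f≗g x) (f≗g y) (pres x y xy))
    , x , y , xy , subst₂ (SamePair u v) (f≗g x) (f≗g y) same

  dec : Decidable IsCopyUsing
  dec f =
          Fin.all? (λ x → Fin.all? λ y → (f x ≟ f y) →-dec (x ≟ y))
    ×-dec Fin.all? (λ x → Fin.all? λ y → adj? H x y →-dec adj? G (f x) (f y))
    ×-dec Fin.any? (λ x → Fin.any? λ y → adj? H x y ×-dec samePair? u v (f x) (f y))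

  to : ∃ IsCopyUsing → Σ (Copy H G) λ f → CopyUses f u v
  to (f , inj , pres , uses) =
    record { embed = f ; injective = inj _ _ ; preserves = pres _ _ } , uses

  from : (Σ (Copy H G) λ f → CopyUses f u v) → ∃ IsCopyUsing
  from (f , uses) =
    embed f , (λ _ _ → injective f) , (λ _ _ → preserves f) , uses

semiSaturated? : (H : Graph k) → Decidable (SemiSaturated {n = n} H)
semiSaturated? H G = Fin.all? λ u → Fin.all? λ v → dec u v
  where
  dec : ∀ u v → Dec ((e : Adj (complement G) u v) →
    Σ (Copy H (addEdge G u v (proj₁ e))) λ f → CopyUses f u v)
  dec u v with adj? (complement G) u v
  ... | no ¬e = yes (λ e → contradiction e ¬e)
  -- Adjacency in `addEdge` does not depend on the proof of `u ≢ v`, so a copy found for one `e`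
  -- serves for every other.
  ... | yes e = map′ (λ (f , uses) _ → mapCopy id f , uses) (λ sat → sat e)
                  (copyUsing? H (addEdge G u v (proj₁ e)) u v)

-- Used to pass from `G` to `decode (encode G)`, which is known to agree with `G` only in adjacency.
semiSaturated-resp : (H : Graph k) (G G′ : Graph n) → G ⊆ G′ → G′ ⊆ G →
  SemiSaturated H G → SemiSaturated H G′
semiSaturated-resp H G G′ G⊆G′ G′⊆G sat u v (u≢v , ¬uv) =
  let f , uses = sat u v (u≢v , ¬uv ∘ G⊆G′) in mapCopy (Sum.map₁ G⊆G′) f , uses

-- Enumeration of the graphs on `n` vertices and existence of the minimum.

completeGraph : Graph n
completeGraph = record
  { Adj    = _≢_
  ; adj?   = λ u v → ¬? (u ≟ v)
  ; adjSym = λ u≢v → u≢v ∘ sym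
  ; noLoop = λ u≢u → u≢u refl
  }

-- The code is an adjacency matrix in which the entry zero marks an edge; an edge needs
-- both of its entries, so that every code is a graph.
decode : Fin ((2 ^ n) ^ n) → Graph n
decode {n} i = record
  { Adj    = λ u v → u ≢ v × bit u v ≡ zero × bit v u ≡ zero
  ; adj?   = λ u v → ¬? (u ≟ v) ×-dec (bit u v ≟ zero) ×-dec (bit v u ≟ zero)
  ; adjSym = λ (u≢v , uv , vu) → u≢v ∘ sym , vu , uv
  ; noLoop = λ (u≢u , _) → u≢u refl
  }
  where
  bit : Fin n → Fin n → Fin 2
  bit u v = finToFun (finToFun {2 ^ n} i u) v

dec⇒bit : ∀ {a} {A : Set a} → Dec A → Fin 2
dec⇒bit (yes _) = zero
dec⇒bit (no  _) = suc zero

encode : Graph n → Fin ((2 ^ n) ^ n)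
encode G = funToFin λ u → funToFin λ v → dec⇒bit (adj? G u v)

module _ (G : Graph n) where

  private
    bit≡ : ∀ u v → finToFun (finToFun {2 ^ n} (encode G) u) v ≡ dec⇒bit (adj? G u v)
    bit≡ u v = trans
      (cong (λ row → finToFun row v)
        (Fin.finToFun-funToFin (λ u → funToFin λ v → dec⇒bit (adj? G u v)) u))
      (Fin.finToFun-funToFin (λ v → dec⇒bit (adj? G u v)) v)

    Adj⇒bit : ∀ {u v} → Adj G u v → finToFun (finToFun {2 ^ n} (encode G) u) v ≡ zero
    Adj⇒bit {u} {v} uv with adj? G u v | bit≡ u v
    ... | yes _   | eq = eq
    ... | no  ¬uv | _  = contradiction uv ¬uv

    bit⇒Adj : ∀ {u v} → finToFun (finToFun {2 ^ n} (encode G) u) v ≡ zero → Adj G u v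
    bit⇒Adj {u} {v} bit≡0 with adj? G u v | bit≡ u v
    ... | yes uv | _  = uv
    ... | no  _  | eq with () ← trans (sym bit≡0) eq

  ⊆-decode-encode : G ⊆ decode (encode G)
  ⊆-decode-encode uv = (λ { refl → noLoop G uv }) , Adj⇒bit uv , Adj⇒bit (adjSym G uv)

  decode-encode-⊆ : decode (encode G) ⊆ G
  decode-encode-⊆ (_ , uv , _) = bit⇒Adj uv

-- Semi-saturation is decidable and every graph has a code, so the minimum is found by search. The
-- complete graph, vacuously semi-saturated, is the default value.
ssat-exists : (n : ℕ) (H : Graph k) → ∃[ t ] ssat[ n , H ]≡ t
ssat-exists n H = edgeCount G , (G , semiSaturated , refl) , minimal
  where
  candidates : List (Graph n)
  candidates = filter (semiSaturated? H) (map decode (allFin ((2 ^ n) ^ n)))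

  G : Graph n
  G = argmin edgeCount completeGraph candidates

  semiSaturated : SemiSaturated H G
  semiSaturated = argmin-all edgeCount {P = SemiSaturated H}
    (λ u v (u≢v , ¬u≢v) → contradiction u≢v ¬u≢v)
    (all-filter (semiSaturated? H) (map decode (allFin ((2 ^ n) ^ n))))

  minimal : ∀ G′ → SemiSaturated H G′ → edgeCount G ≤ edgeCount G′
  minimal G′ sat = subst (edgeCount G ≤_)
    (edgeCount-cong (decode (encode G′)) G′ (decode-encode-⊆ G′) (⊆-decode-encode G′))
    (All.lookup (f[argmin]≤f[xs] {f = edgeCount} completeGraph candidates)
      (∈-filter⁺ (semiSaturated? H) (∈-map⁺ decode (∈-allFin (encode G′)))
        (semiSaturated-resp H G′ (decode (encode G′)) (⊆-decode-encode G′) (decode-encode-⊆ G′) sat)))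

-- A fresh colour on the added edge: from rainbow saturation to semi-saturation.

module FreshColour {G : Graph n} (c : ProperColouring G) {u v : Fin n} (u≢v : u ≢ v) where

  private
    -- `nothing` is the fresh colour. The decision is an argument so that the proofs below can split
    -- on it directly.
    col : ∀ {x y} → Dec (SamePair u v x y) → Maybe (Colour c)
    col         (yes _) = nothing
    col {x} {y} (no  _) = just (colour c x y)

    col-old : ∀ {x y} (d : Dec (SamePair u v x y)) → ¬ SamePair u v x y →
      col d ≡ just (colour c x y)
    col-old (yes same) ¬same = contradiction same ¬same
    col-old (no  _)    _     = refl

    col-sym : ∀ {x y} (d : Dec (SamePair u v x y)) (d′ : Dec (SamePair u v y x)) → col d ≡ col d′
    col-sym (yes _)    (yes _)     = refl
    col-sym (yes same) (no  ¬same) = contradiction (samePair-sym same) ¬same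
    col-sym (no  ¬same) (yes same) = contradiction (samePair-sym same) ¬same
    col-sym (no  _)    (no  _)     = cong just (colourSym c _ _)

    col-proper : ∀ {x y z} (d : Dec (SamePair u v x y)) (d′ : Dec (SamePair u v x z)) →
      Adj (addEdge G u v u≢v) x y → Adj (addEdge G u v u≢v) x z → y ≢ z → col d ≢ col d′
    col-proper (yes xy)  (yes xz) _ _ y≢z _ = y≢z (samePair-functional u≢v xy xz)
    col-proper (no  ¬xy) d′ (inj₂ xy) _ _ _ = ¬xy xy
    col-proper d (no  ¬xz) _ (inj₂ xz) _ _  = ¬xz xz
    col-proper (no _) (no _) (inj₁ xy) (inj₁ xz) y≢z = proper c xy xz y≢z ∘ just-injective

  extend : ProperColouring (addEdge G u v u≢v)
  extend = record
    { Colour    = Maybe (Colour c)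
    ; _≟ᶜ_      = ≡-decᴹ (ProperColouring._≟ᶜ_ c)
    ; colour    = λ x y → col (samePair? u v x y)
    ; colourSym = λ x y → col-sym (samePair? u v x y) (samePair? u v y x)
    ; proper    = λ {x} {y} {z} → col-proper (samePair? u v x y) (samePair? u v x z)
    }

  extend-old : ∀ {x y} → ¬ SamePair u v x y → colour extend x y ≡ just (colour c x y)
  extend-old {x} {y} = col-old (samePair? u v x y)

saturated⇒semiSaturated : (H : Graph k) (G : Graph n) →
  ProperlyRainbowSaturated H G → SemiSaturated H G
saturated⇒semiSaturated H G ((c , noRainbow) , sat) u v e@(u≢v , _)
  with f , rainbow ← sat u v e (FreshColour.extend c u≢v)
  with copyUses? f u v
... | yes uses = f , uses
-- A copy avoiding `u v` lies in `G`, and there the extended colouring is `c` followed by `just`, so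
-- the copy would already be rainbow for `c`.
... | no ¬uses = contradiction (oldCopy , λ {_} {_} {_} {_} → oldRainbow) noRainbow
  where
  open FreshColour c u≢v

  avoids : ∀ {x y} → Adj H x y → ¬ SamePair u v (embed f x) (embed f y)
  avoids xy same = ¬uses (_ , _ , xy , same)

  oldCopy : Copy H G
  oldCopy = record
    { embed     = embed f
    ; injective = injective f
    ; preserves = λ xy → [ id , (λ same → contradiction same (avoids xy)) ]′ (preserves f xy)
    }

  oldRainbow : Rainbow c oldCopy
  oldRainbow xy x′y′ distinct same = rainbow xy x′y′ distinct
    (trans (extend-old (avoids xy)) (trans (cong just same) (sym (extend-old (avoids x′y′)))))

-- Isolated vertices and the bound ⌊n/2⌋.

isolated-vertices-unique : (H : Graph k) (G : Graph n) → NoIsolatedEdge H → SemiSaturated H G →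
  ∀ {u v} → u ≢ v → (∀ w → ¬ Adj G u w) → (∀ w → ¬ Adj G v w) → ⊥
isolated-vertices-unique {k} {n} H G noIsolatedEdge sat {u} {v} u≢v isolated-u isolated-v =
  noIsolatedEdge x y (xy , λ w → mk⇔ (λ xw → confined xw (inj₁ refl)) reach)
  where
  copy = sat u v (u≢v , isolated-u v)
  f  = proj₁ copy
  x  = proj₁ (proj₂ copy)
  y  = proj₁ (proj₂ (proj₂ copy))
  xy = proj₁ (proj₂ (proj₂ (proj₂ copy)))

  image : SamePair u v (embed f x) (embed f y)
  image = proj₂ (proj₂ (proj₂ (proj₂ copy)))

  image⇒¬Adj : ∀ {z w} → SamePair u v (embed f x) (embed f y) →
    z ≡ x ⊎ z ≡ y → ¬ Adj G (embed f z) w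
  image⇒¬Adj (inj₁ (fx≡u , _)) (inj₁ refl) zw = isolated-u _ (subst (λ a → Adj G a _) fx≡u zw)
  image⇒¬Adj (inj₂ (fx≡v , _)) (inj₁ refl) zw = isolated-v _ (subst (λ a → Adj G a _) fx≡v zw)
  image⇒¬Adj (inj₁ (_ , fy≡v)) (inj₂ refl) zw = isolated-v _ (subst (λ a → Adj G a _) fy≡v zw)
  image⇒¬Adj (inj₂ (_ , fy≡u)) (inj₂ refl) zw = isolated-u _ (subst (λ a → Adj G a _) fy≡u zw)

  onEdge : ∀ {a w} → SamePair u v (embed f x) (embed f y) → SamePair u v a (embed f w) →
    w ≡ x ⊎ w ≡ y
  onEdge (inj₁ (_ , fy≡v)) (inj₁ (_ , fw≡v)) = inj₂ (injective f (trans fw≡v (sym fy≡v)))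
  onEdge (inj₁ (fx≡u , _)) (inj₂ (_ , fw≡u)) = inj₁ (injective f (trans fw≡u (sym fx≡u)))
  onEdge (inj₂ (fx≡v , _)) (inj₁ (_ , fw≡v)) = inj₁ (injective f (trans fw≡v (sym fx≡v)))
  onEdge (inj₂ (_ , fy≡u)) (inj₂ (_ , fw≡u)) = inj₂ (injective f (trans fw≡u (sym fy≡u)))

  -- The images of `x` and `y` are `u` and `v`, isolated in `G`, so every step of a walk from `x` or
  -- `y` maps to the added edge.
  confined : ∀ {z w} → Reachable H z w → z ≡ x ⊎ z ≡ y → w ≡ x ⊎ w ≡ y
  confined ε           z∈xy = z∈xy
  confined (zz′ ◅ z′w) z∈xy with preserves f zz′
  ... | inj₁ old = contradiction old (image⇒¬Adj image z∈xy)
  ... | inj₂ new = confined z′w (onEdge image new)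

  reach : ∀ {w} → w ≡ x ⊎ w ≡ y → Reachable H x w
  reach (inj₁ refl) = ε
  reach (inj₂ refl) = xy ◅ ε

semiSaturated⇒⌊n/2⌋≤ : (H : Graph k) (G : Graph n) → NoIsolatedEdge H → SemiSaturated H G →
  ⌊ n /2⌋ ≤ edgeCount G
semiSaturated⇒⌊n/2⌋≤ {n = n} H G noIsolatedEdge sat = begin
  ⌊ n /2⌋                                ≤⟨ ℕ.⌊n/2⌋-mono (missing-unique⇒≤ endpoints unique) ⟩
  ⌊ suc (length endpoints) /2⌋           ≡⟨ cong (λ m → ⌊ suc m /2⌋) length-endpoints ⟩
  -- The extra one, for a possible isolated vertex, is lost in halving: ⌊(m + 1)/2⌋ is ⌈m/2⌉ by
  -- definition.
  ⌊ suc (edgeCount G + edgeCount G) /2⌋  ≡⟨ ℕ.n≡⌈n+n/2⌉ (edgeCount G) ⟨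
  edgeCount G                            ∎
  where
  open ℕ.≤-Reasoning

  endpoints : List (Fin n)
  endpoints = map proj₁ (edges G) ++ map proj₂ (edges G)

  length-endpoints : length endpoints ≡ edgeCount G + edgeCount G
  length-endpoints = trans (length-++ (map proj₁ (edges G)))
    (cong₂ _+_ (length-map proj₁ (edges G)) (length-map proj₂ (edges G)))

  missing⇒isolated : ∀ {u} → u ∉ endpoints → ∀ w → ¬ Adj G u w
  missing⇒isolated u∉ w uw = [ u∉ ∘ ∈-++⁺ˡ ∘ ∈-map⁺ proj₁
                             , u∉ ∘ ∈-++⁺ʳ (map proj₁ (edges G)) ∘ ∈-map⁺ proj₂ ]′ (Adj⇒Joined G uw)

  unique : ∀ {u v} → u ≢ v → u ∉ endpoints → v ∉ endpoints → ⊥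
  unique u≢v u∉ v∉ = isolated-vertices-unique H G noIsolatedEdge sat u≢v
    (missing⇒isolated u∉) (missing⇒isolated v∉)

-- Tree components and the bound n - 1.

-- The labels outside spoiled mark tree components: each edge of such a component has
-- a cut, that is, a function on the vertices which, inside the component, changes
-- along this edge only.  A label outside spoiled is one of the vertices carrying it.
record ForestLabelling (es : List (Fin n × Fin n)) (spoiled : List (Fin n)) : Set where
  field
    label : Fin n → Fin n
    root  : ∀ {r} → r ∉ spoiled → label r ≡ r
    label-edge : ∀ {p q} → (p , q) ∈ es → label p ≡ label q
    cut   : ∀ {a b} → (a , b) ∈ es → label a ∉ spoiled →
      Σ (Fin n → Fin n) λ f → f a ≢ f b ×
        (∀ {p q} → (p , q) ∈ es → label p ≡ label a → ¬ SamePair a b p q → f p ≡ f q)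

  label-joined : ∀ {p q} → Joined es p q → label p ≡ label q
  label-joined = [ label-edge , sym ∘ label-edge ]′

  cut-joined : ∀ {a b} → Joined es a b → label a ∉ spoiled →
    Σ (Fin n → Fin n) λ f → f a ≢ f b ×
      (∀ {p q} → Joined es p q → label p ≡ label a → ¬ SamePair a b p q → f p ≡ f q)
  cut-joined {a} {b} (inj₁ ab) a-good with f , fa≢fb , along ← cut ab a-good = f , fa≢fb , λ
    { (inj₁ pq) p~a distinct → along pq p~a distinct
    ; (inj₂ qp) p~a distinct →
        sym (along qp (trans (label-edge qp) p~a) (distinct ∘ samePair-sym)) }
  cut-joined {a} {b} (inj₂ ba) a-good
    with f , fb≢fa , along ← cut ba (a-good ∘ subst (_∈ spoiled) (label-edge ba)) =
    f , fb≢fa ∘ sym , λ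
    { (inj₁ pq) p~a distinct → along pq (trans p~a (sym (label-edge ba))) (distinct ∘ Sum.swap)
    ; (inj₂ qp) p~a distinct →
        sym (along qp (trans (label-edge qp) (trans p~a (sym (label-edge ba))))
              (distinct ∘ Sum.swap ∘ samePair-sym)) }

  -- If the label were good, the closing edge would have a cut. This cut is constant along the rest
  -- of the cycle, so it agrees at both ends of the closing edge.
  acyclic : ∀ {l} (c : Fin (3 + l) → Fin n) → Injective _≡_ _≡_ c →
    (∀ i → Joined es (c (inject₁ i)) (c (suc i))) →
    Joined es (c (fromℕ (2 + l))) (c zero) →
    label (c zero) ∈ spoiled
  acyclic {l} c c-inj path closing = decidable-stable (_∈?_ _≟_ _ _) λ good →
    let last~0 = label-joined closing
        f , f-last≢f-0 , along = cut-joined closing (good ∘ subst (_∈ spoiled) last~0)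
    in f-last≢f-0 (sym (<-weakInduction (λ i → f (c zero) ≡ f (c i)) refl
         (λ i f0≡fi → trans f0≡fi
           (along (path i) (trans (label-path (inject₁ i)) (sym last~0)) (distinct i)))
         (fromℕ (2 + l))))
    where
    label-path : ∀ i → label (c i) ≡ label (c zero)
    label-path = <-weakInduction (λ i → label (c i) ≡ label (c zero)) refl
      (λ i → trans (sym (label-joined (path i))))

    distinct : ∀ i → ¬ SamePair (c (fromℕ (2 + l))) (c zero) (c (inject₁ i)) (c (suc i))
    distinct i       (inj₁ (i≡last , _)) = fromℕ≢inject₁ (sym (c-inj i≡last))
    -- Here the length of at least three matters: the second vertex is not the last.
    distinct zero    (inj₂ (_ , 1≡last)) with () ← c-inj 1≡last
    distinct (suc i) (inj₂ (i≡0 , _))    with () ← c-inj i≡0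

open ForestLabelling

edgeless : ForestLabelling {n} [] []
edgeless = record { label = id ; root = λ _ → refl ; label-edge = λ () ; cut = λ () }

-- The edge x y merges the class of y into that of x.  The label of y is then no longer in
-- use, and the merged component is not a tree if one of the classes was not, or if they
-- coincide.  The two hypotheses ensure that spoiling z alone accounts for all of this.
module Join {es : List (Fin n × Fin n)} {spoiled : List (Fin n)}
  (F : ForestLabelling es spoiled) (x y z : Fin n)
  (y-spoiled : label F y ∈ z ∷ spoiled)
  (x-spoiled : label F y ∈ spoiled → label F x ∈ z ∷ spoiled) where

  private
    patch : (f g : Fin n → Fin n) → Fin n → Fin n
    patch f g w with label F w ≟ label F y
    ... | yes _ = f w
    ... | no  _ = g w

    patch-in : ∀ f g {w} → label F w ≡ label F y → patch f g w ≡ f w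
    patch-in f g {w} w~y with label F w ≟ label F y
    ... | yes _   = refl
    ... | no  w≁y = contradiction w~y w≁y

    patch-out : ∀ f g {w} → label F w ≢ label F y → patch f g w ≡ g w
    patch-out f g {w} w≁y with label F w ≟ label F y
    ... | yes w~y = contradiction w~y w≁y
    ... | no  _   = refl

    patch-edge : ∀ f g {p q} → (p , q) ∈ es →
      (label F p ≡ label F y → f p ≡ f q) → (label F p ≢ label F y → g p ≡ g q) →
      patch f g p ≡ patch f g q
    patch-edge f g {p} {q} pq inside outside with label F p ≟ label F y
    ... | yes p~y = trans (inside p~y) (sym (patch-in f g (trans (sym (label-edge F pq)) p~y)))
    ... | no  p≁y = trans (outside p≁y) (sym (patch-out f g (p≁y ∘ trans (label-edge F pq))))

    patch-const : ∀ f → patch (λ _ → f x) f x ≡ f x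
    patch-const f with label F x ≟ label F y
    ... | yes _ = refl
    ... | no  _ = refl

    relabel : Fin n → Fin n
    relabel = patch (λ _ → label F x) (label F)

    x-good⇒x≁y : label F x ∉ z ∷ spoiled → label F x ≢ label F y
    x-good⇒x≁y x-good x~y = x-good (subst (_∈ z ∷ spoiled) (sym x~y) y-spoiled)

    join-cut : ∀ {a b} → (a , b) ∈ (x , y) ∷ es → relabel a ∉ z ∷ spoiled →
      Σ (Fin n → Fin n) λ f → f a ≢ f b ×
        (∀ {p q} → (p , q) ∈ (x , y) ∷ es → relabel p ≡ relabel a → ¬ SamePair a b p q → f p ≡ f q)
    join-cut (here refl) good =
        -- The old labels cut the new edge: they are constant along old edges, and they differ at
        -- `x` and `y`, as otherwise the merged label would be spoiled.
        label F
      , x-good⇒x≁y (good ∘ subst (_∈ z ∷ spoiled) (sym (patch-const (label F))))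
      , λ { (here refl) _ distinct → contradiction (inj₁ (refl , refl)) distinct
          ; (there pq)  _ _        → label-edge F pq }
    join-cut {a} {b} (there ab) good with label F a ≟ label F y
    -- A cut on the class of `y` is continued outside by the constant `f y`, so it does not change
    -- along the new edge.
    ... | yes a~y
      with f , fa≢fb , along ← cut F ab (good ∘ x-spoiled ∘ subst (_∈ spoiled) a~y) =
        f′
      , (λ f′a≡f′b → fa≢fb (trans (sym (patch-in f _ a~y))
            (trans f′a≡f′b (patch-in f _ (trans (sym (label-edge F ab)) a~y)))))
      , λ { (here refl) _ _ →
              trans (patch-out f _ (x-good⇒x≁y good)) (sym (patch-in f _ refl))
          ; (there pq) _ distinct → patch-edge f _ pq
              (λ p~y → along pq (trans p~y (sym a~y)) distinct) (λ _ → refl) }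
      where f′ = patch f (λ _ → f y)
    -- Symmetrically, the class of `y` receives the constant `f x`.
    ... | no  a≁y with f , fa≢fb , along ← cut F ab (good ∘ there) =
        f′
      , (λ f′a≡f′b → fa≢fb (trans (sym (patch-out _ f a≁y))
            (trans f′a≡f′b (patch-out _ f (a≁y ∘ trans (label-edge F ab))))))
      , λ { (here refl) _ _ → trans (patch-const f) (sym (patch-in _ f refl))
          ; (there pq) p~a distinct → patch-edge _ f pq (λ _ → refl)
              (λ p≁y → along pq (trans (sym (patch-out _ (label F) p≁y)) p~a) distinct) }
      where f′ = patch (λ _ → f x) f

  join : ForestLabelling ((x , y) ∷ es) (z ∷ spoiled)
  join = record
    { label      = relabel
    ; root       = λ {r} r-good →
        let r≡ = root F (r-good ∘ there) in
        trans (patch-out _ _ λ r~y →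
                r-good (subst (_∈ z ∷ spoiled) (trans (sym r~y) r≡) y-spoiled))
              r≡
    ; label-edge = λ
        { (here refl) → trans (patch-const (label F)) (sym (patch-in _ _ refl))
        ; (there pq)  → patch-edge _ _ pq (λ _ → refl) (λ _ → label-edge F pq) }
    ; cut        = join-cut
    }

-- One label is spoiled per edge. If that of `y` is already spoiled, the merged component is not a
-- tree, so the label of `x` is spoiled. Otherwise that of `y` is: it is either retired by the
-- merge, or equal to that of `x` when the edge closes a cycle. Repetitions are harmless, since only
-- the length is used.
forestLabelling : (es : List (Fin n × Fin n)) →
  ∃[ spoiled ] length spoiled ≡ length es × ForestLabelling es spoiled
forestLabelling [] = [] , refl , edgeless
forestLabelling ((x , y) ∷ es) with forestLabelling es
... | spoiled , len , F with _∈?_ _≟_ (label F y) spoiled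
...   | yes y∈ = label F x ∷ spoiled , cong suc len
               , Join.join F x y (label F x) (there y∈) (λ _ → here refl)
...   | no  y∉ = label F y ∷ spoiled , cong suc len
               , Join.join F x y (label F y) (here refl) (λ y∈ → contradiction y∈ y∉)

tree-components-unique : (H : Graph k) (G : Graph n) → Connected H → ContainsCycle H →
  SemiSaturated H G → ∀ {spoiled} → ForestLabelling (edges G) spoiled →
  ∀ {u v} → u ≢ v → u ∉ spoiled → v ∉ spoiled → ⊥
tree-components-unique H G connected (_ , c , c-inj , path , closing) sat {spoiled} F {u} {v}
  -- Good labels are their own labels, and adjacent vertices share a label, so `u` and `v` are not
  -- adjacent.
  u≢v u∉ v∉ with sat u v (u≢v , λ uv →
    u≢v (trans (sym (root F u∉)) (trans (label-joined F (Adj⇒Joined G uv)) (root F v∉))))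
... | f , x , y , _ , same = u-good (subst (_∈ v ∷ spoiled) (label-image (c zero))
        (acyclic F+uv (embed f ∘ c) (c-inj ∘ injective f)
          (joined ∘ preserves f ∘ path) (joined (preserves f closing))))
  where
  F+uv : ForestLabelling ((u , v) ∷ edges G) (v ∷ spoiled)
  -- Only `v` is newly spoiled; the merged tree keeps the good label `u`. The connected copy meets
  -- `u v`, so its cycle carries the label `u`, against `acyclic`.
  F+uv = Join.join F u v v (here (root F v∉))
    (λ v∈ → contradiction (subst (_∈ spoiled) (root F v∉) v∈) v∉)

  u-good : u ∉ v ∷ spoiled
  u-good (here u≡v) = u≢v u≡v
  u-good (there u∈) = u∉ u∈

  joined : ∀ {p q} → Adj (addEdge G u v u≢v) p q → Joined ((u , v) ∷ edges G) p q
  joined (inj₁ pq)                   = Sum.map there there (Adj⇒Joined G pq)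
  joined (inj₂ (inj₁ (refl , refl))) = inj₁ (here refl)
  joined (inj₂ (inj₂ (refl , refl))) = inj₂ (here refl)

  label-x : SamePair u v (embed f x) (embed f y) → label F+uv (embed f x) ≡ u
  label-x (inj₁ (fx≡u , _)) = trans (cong (label F+uv) fx≡u) (root F+uv u-good)
  label-x (inj₂ (fx≡v , _)) = trans (cong (label F+uv) fx≡v)
    (trans (sym (label-edge F+uv (here refl))) (root F+uv u-good))

  label-reachable : ∀ {w w′} → Reachable H w w′ →
    label F+uv (embed f w) ≡ label F+uv (embed f w′)
  label-reachable ε            = refl
  label-reachable (step ◅ path) =
    trans (label-joined F+uv (joined (preserves f step))) (label-reachable path)

  label-image : ∀ w → label F+uv (embed f w) ≡ u
  label-image w = trans (label-reachable (connected w x)) (label-x same)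

semiSaturated⇒n∸1≤ : (H : Graph k) (G : Graph n) → Connected H → ContainsCycle H →
  SemiSaturated H G → n ∸ 1 ≤ edgeCount G
semiSaturated⇒n∸1≤ H G connected cycle sat with forestLabelling (edges G)
... | spoiled , len , F = subst (_ ≤_) len
  (ℕ.∸-monoˡ-≤ 1 (missing-unique⇒≤ spoiled (tree-components-unique H G connected cycle sat F)))

-- From bounds on semi-saturated graphs to the two invariants.

ssat-bounds : (H : Graph k) (bound : ℕ) →
  (∀ (G : Graph n) → SemiSaturated H G → bound ≤ edgeCount G) →
  ∃[ t ] ssat[ n , H ]≡ t × (∀ s → sat*[ n , H ]≡ s → s ≥ t) × t ≥ bound
ssat-bounds {n = n} H bound bound≤ with ssat-exists n H
... | t , ssat@((G , sat , count) , minimal) =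
    t , ssat
  , (λ { s ((G* , sat* , refl) , _) → minimal G* (saturated⇒semiSaturated H G* sat*) })
  , subst (bound ≤_) count (bound≤ G sat)

theorem1p5 : ∀ (n : ℕ) .{{_ : NonZero n}} →
    (∀ {k} (H : Graph k) → NoIsolatedEdge H →
    ∃[ t ] ssat[ n , H ]≡ t × (∀ s → sat*[ n , H ]≡ s → s ≥ t) × t ≥ ⌊ n /2⌋)
    × (∀ {k} (H : Graph k) → Connected H → ContainsCycle H →
    ∃[ t ] ssat[ n , H ]≡ t × (∀ s → sat*[ n , H ]≡ s → s ≥ t) × t ≥ n ∸ 1)
theorem1p5 n =
    (λ H noIsolatedEdge → ssat-bounds H ⌊ n /2⌋ λ G →
       semiSaturated⇒⌊n/2⌋≤ H G noIsolatedEdge)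
  , (λ H connected cycle → ssat-bounds H (n ∸ 1) λ G →
       semiSaturated⇒n∸1≤ H G connected cycle)
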